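{- For every integer $n\ge 3$, let $s(n)=\sum_{T\in\mathcal{PT}(n)}(-1)^{\mathrm{urc}(T)}$. Then $$s(n)=2\,s(n-1)-2\,s(n-2).$$
   Context: A partition $\lambda=(\lambda_1,\dots,\lambda_r)$ with $\lambda_1\ge\cdots\ge\lambda_r\ge 0$ (zero parts allowed) has Ferrers diagram the left-justified array with $\lambda_i$ cells in row $i$; its length is the total number of rows (including empty rows) and columns. A permutation tableau of length $n$ is a $0,1$-filling of the Ferrers diagram of such a partition, of length $n$, such that (1) each column contains at least one $1$, and (2) no $0$ has simultaneously a $1$ above it in its column and a $1$ to its left in its row. $\mathcal{PT}(n)$ denotes the set of permutation tableaux of length $n$. A $0$ in a permutation tableau is column-restricted if there is a $1$ to its left in the same row. A column is unrestricted if it contains no column-restricted $0$. $\mathrm{urc}(T)$ is the number of unrestricted columns of $T$. -}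

module Defs where

-- Permutation tableaux, encoded as a list of rows, each row a list of Bools
-- (true = 1, false = 0).  Row i (0-based, top to bottom) has λ_i cells,
-- left-justified; column j (0-based, left to right).  The number of rows r
-- (including empty rows) is the length of the outer list; the number of
-- columns is λ_1 (the length of the first row, 0 if there are no rows).

open import Data.Bool using (Bool; true; false; _∧_; _∨_; not; if_then_else_)
open import Data.Nat using (ℕ; zero; suc; _+_; _≤ᵇ_; _≡ᵇ_)
open import Data.List using (List; []; _∷_; length; map; concatMap; filter; upTo; foldr)
open import Data.Bool.ListAction using (any; all)
open import Data.Maybe using (Maybe; just; nothing)
open import Data.Integer using (ℤ; -_) renaming (_+_ to _+ℤ_)
open import Relation.Nullary.Decidable using (yes; no)
open import Data.Bool using (T?)

Filling : Set
Filling = List (List Bool)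

_!?_ : {A : Set} → List A → ℕ → Maybe A
[] !? _ = nothing
(x ∷ xs) !? zero = just x
(x ∷ xs) !? suc k = xs !? k

one? : Filling → ℕ → ℕ → Bool
one? F i j with F !? i
... | nothing = false
... | just row with row !? j
...   | nothing = false
...   | just b = b

zero? : Filling → ℕ → ℕ → Bool
zero? F i j with F !? i
... | nothing = false
... | just row with row !? j
...   | nothing = false
...   | just b = not b

numRows : Filling → ℕ
numRows = length

numCols : Filling → ℕ
numCols [] = 0
numCols (row ∷ _) = length row

-- row lengths weakly decreasing: the rows form a Ferrers diagram
decreasing : Filling → Bool
decreasing [] = true
decreasing (r ∷ []) = true
decreasing (r ∷ r' ∷ rs) = (length r' ≤ᵇ length r) ∧ decreasing (r' ∷ rs)

anyBelow : ℕ → (ℕ → Bool) → Bool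
anyBelow m p = any p (upTo m)

allBelow : ℕ → (ℕ → Bool) → Bool
allBelow m p = all p (upTo m)

colsHaveOne : Filling → Bool
colsHaveOne F = allBelow (numCols F) (λ j → anyBelow (numRows F) (λ i → one? F i j))

oneAbove : Filling → ℕ → ℕ → Bool
oneAbove F i j = anyBelow i (λ i' → one? F i' j)

oneLeft : Filling → ℕ → ℕ → Bool
oneLeft F i j = anyBelow j (λ j' → one? F i j')

noBadZero : Filling → Bool
noBadZero F =
  allBelow (numRows F) (λ i → allBelow (numCols F) (λ j →
    not (zero? F i j ∧ oneAbove F i j ∧ oneLeft F i j)))

isPT : ℕ → Filling → Bool
isPT n F = decreasing F ∧ (numRows F + numCols F ≡ᵇ n) ∧ colsHaveOne F ∧ noBadZero F

listsOf : {A : Set} → ℕ → List A → List (List A)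
listsOf zero xs = [] ∷ []
listsOf (suc r) xs = concatMap (λ x → map (x ∷_) (listsOf r xs)) xs

rowsUpTo : ℕ → List (List Bool)
rowsUpTo n = concatMap (λ k → listsOf k (true ∷ false ∷ [])) (upTo (suc n))

-- all fillings with at most n rows, each of length at most n
-- (every permutation tableau of length n is among these, each exactly once)
candidates : ℕ → List Filling
candidates n = concatMap (λ r → listsOf r (rowsUpTo n)) (upTo (suc n))

PT : ℕ → List Filling
PT n = filter (λ F → T? (isPT n F)) (candidates n)

colRestricted : Filling → ℕ → ℕ → Bool
colRestricted F i j = zero? F i j ∧ oneLeft F i j

unrestricted : Filling → ℕ → Bool
unrestricted F j = allBelow (numRows F) (λ i → not (colRestricted F i j))

urc : Filling → ℕ
urc F = foldr _+_ 0 (map (λ j → if unrestricted F j then 1 else 0) (upTo (numCols F)))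

signPow : ℕ → ℤ
signPow zero = Data.Integer.1ℤ
signPow (suc k) = - signPow k

s : ℕ → ℤ
s n = foldr _+ℤ_ Data.Integer.0ℤ (map (λ F → signPow (urc F)) (PT n))

{-# OPTIONS --safe #-}

-- Read a tableau from left to right, remembering for every row whether it already contains a 1:
-- a step either deletes an empty bottom row or deletes the first column, and the sign of that
-- column depends only on the remembered word. Dually, read from right to left, the state is a
-- product of row functionals, each either "anything" (a free row) or "no 1 to the left".
-- Writing (-1)^[column unrestricted] = 1 - 2[column unrestricted], a new column acts on a state
-- through its k free rows only, and sends u^k to u((1+u)^k - u^k) - 2((1+u)^k - 1), while a new
-- row sends u^k to u^(k+1). Hence s(n) = f_n(1) where f_0 = 1 and
--   f_{n+1}(u) = (u - 2) f_n(u + 1) + 2 f_n(1),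
-- and evaluating at u = 1 and at u = 2, where the first term vanishes, gives the recurrence.

module Submission where

open import Defs
open import Data.Nat using (ℕ; _≤_; _∸_; zero; suc; z≤n; s≤s; _≤ᵇ_; _≡ᵇ_)
import Data.Nat as ℕ
import Data.Nat.Properties as ℕₚ
open import Data.Integer using (ℤ; _*_; _-_; +_; -_; 0ℤ; 1ℤ; -1ℤ) renaming (_+_ to _⊕_)
import Data.Integer.Properties as ℤₚ
open import Data.Integer.Tactic.RingSolver using (solve-∀)
open import Data.Bool using (Bool; true; false; _∧_; _∨_; not; if_then_else_; T?)
open import Data.Bool.Properties using (∨-assoc; ∨-identityʳ; ∨-zeroʳ; ∧-zeroʳ)
open import Data.Bool.ListAction using (any; all)
open import Data.Fin using (Fin; toℕ) renaming (zero to fzero; suc to fsuc)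
open import Data.List using (List; []; _∷_; _++_; _∷ʳ_; length; map; concatMap; filter; upTo; applyUpTo; foldr)
open import Data.List.Properties using (length-++)
open import Data.Maybe using (Maybe; just; nothing)
open import Data.Product using (_×_; _,_; proj₁; proj₂)
open import Data.Vec using (Vec; []; _∷_; toList; zipWith; replicate; lookup; initLast)
  renaming (_∷ʳ_ to infixl 6 _▹_)
open import Data.Vec.Properties using (lookup-zipWith; lookup-replicate; length-toList)
open import Function using (_∘_; id)
open import Relation.Binary.PropositionalEquality
open ≡-Reasoning

-- Linear functionals on integer-valued functions.

-- Iterated sums and transfer operators are all of this kind, so sums are interchanged with each of
-- them by the same argument. The field `ext` stands in for function extensionality.
record Linear {A : Set} (φ : (A → ℤ) → ℤ) : Set where
  field
    ext   : ∀ {G H} → (∀ x → G x ≡ H x) → φ G ≡ φ H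
    add   : ∀ G H → φ (λ x → G x ⊕ H x) ≡ φ G ⊕ φ H
    scale : ∀ k G → φ (λ x → k * G x) ≡ k * φ G

  null : φ (λ _ → 0ℤ) ≡ 0ℤ
  null = scale 0ℤ (λ _ → 0ℤ)

  null-ext : ∀ {G} → (∀ x → G x ≡ 0ℤ) → φ G ≡ 0ℤ
  null-ext G≡0 = trans (ext G≡0) null

open Linear

private
  variable
    A B : Set
    r : ℕ

point-linear : (x : A) → Linear (λ G → G x)
point-linear x .ext p = p x
point-linear x .add _ _ = refl
point-linear x .scale _ _ = refl

zero-linear : Linear {A} (λ _ → 0ℤ)
zero-linear .ext _ = refl
zero-linear .add _ _ = refl
zero-linear .scale k _ = sym (ℤₚ.*-zeroʳ k)

bind-linear : {φ : (A → ℤ) → ℤ} {ψ : A → (B → ℤ) → ℤ} →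
  Linear φ → (∀ x → Linear (ψ x)) → Linear (λ G → φ (λ x → ψ x G))
bind-linear L M .ext p = ext L (λ x → ext (M x) p)
bind-linear L M .add G H = trans (ext L (λ x → add (M x) G H)) (add L _ _)
bind-linear L M .scale k G = trans (ext L (λ x → scale (M x) k G)) (scale L k _)

pull-linear : {φ : (B → ℤ) → ℤ} (f : B → A) → Linear φ → Linear (λ G → φ (G ∘ f))
pull-linear f L = bind-linear L (λ x → point-linear (f x))

+-linear : {φ ψ : (A → ℤ) → ℤ} → Linear φ → Linear ψ → Linear (λ G → φ G ⊕ ψ G)
+-linear L M .ext p = cong₂ _⊕_ (ext L p) (ext M p)
+-linear {φ = φ} {ψ} L M .add G H = trans (cong₂ _⊕_ (add L G H) (add M G H)) (interchange (φ G) (φ H) (ψ G) (ψ H))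
  where
  interchange : ∀ a b c d → (a ⊕ b) ⊕ (c ⊕ d) ≡ (a ⊕ c) ⊕ (b ⊕ d)
  interchange = solve-∀
+-linear L M .scale k G =
  trans (cong₂ _⊕_ (scale L k G) (scale M k G)) (sym (ℤₚ.*-distribˡ-+ k _ _))

*-linear : {φ : (A → ℤ) → ℤ} (c : ℤ) → Linear φ → Linear (λ G → c * φ G)
*-linear c L .ext p = cong (c *_) (ext L p)
*-linear c L .add G H = trans (cong (c *_) (add L G H)) (ℤₚ.*-distribˡ-+ c _ _)
*-linear {φ = φ} c L .scale k G = trans (cong (c *_) (scale L k G)) (swap c k (φ G))
  where
  swap : ∀ c k x → c * (k * x) ≡ k * (c * x)
  swap = solve-∀

-- Finite sums over lists and vectors.

sumL : List A → (A → ℤ) → ℤ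
sumL xs h = foldr _⊕_ 0ℤ (map h xs)

sumL-linear : (xs : List A) → Linear (sumL xs)
sumL-linear [] = zero-linear
sumL-linear (x ∷ xs) = +-linear (point-linear x) (sumL-linear xs)

sumL-swap : {φ : (B → ℤ) → ℤ} → Linear φ → (xs : List A) (G : A → B → ℤ) →
  sumL xs (λ x → φ (G x)) ≡ φ (λ y → sumL xs (λ x → G x y))
sumL-swap L [] G = sym (null L)
sumL-swap {φ = φ} L (x ∷ xs) G = begin
  φ (G x) ⊕ sumL xs (λ x → φ (G x))               ≡⟨ cong (φ (G x) ⊕_) (sumL-swap L xs G) ⟩
  φ (G x) ⊕ φ (λ y → sumL xs (λ x → G x y))       ≡⟨ add L _ _ ⟨
  φ (λ y → G x y ⊕ sumL xs (λ x → G x y))         ∎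

sumL-++ : (xs ys : List A) (h : A → ℤ) → sumL (xs ++ ys) h ≡ sumL xs h ⊕ sumL ys h
sumL-++ [] ys h = sym (ℤₚ.+-identityˡ _)
sumL-++ (x ∷ xs) ys h =
  trans (cong (h x ⊕_) (sumL-++ xs ys h)) (sym (ℤₚ.+-assoc (h x) _ _))

sumL-map : (f : A → B) (xs : List A) (h : B → ℤ) → sumL (map f xs) h ≡ sumL xs (h ∘ f)
sumL-map f [] h = refl
sumL-map f (x ∷ xs) h = cong (h (f x) ⊕_) (sumL-map f xs h)

sumL-concatMap : (f : A → List B) (xs : List A) (h : B → ℤ) →
  sumL (concatMap f xs) h ≡ sumL xs (λ x → sumL (f x) h)
sumL-concatMap f [] h = refl
sumL-concatMap f (x ∷ xs) h =
  trans (sumL-++ (f x) (concatMap f xs) h) (cong (sumL (f x) h ⊕_) (sumL-concatMap f xs h))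

sumL-filter : (p : A → Bool) (xs : List A) (h : A → ℤ) →
  sumL (filter (λ x → T? (p x)) xs) h ≡ sumL xs (λ x → if p x then h x else 0ℤ)
sumL-filter p [] h = refl
sumL-filter p (x ∷ xs) h with p x
... | true  = cong (h x ⊕_) (sumL-filter p xs h)
... | false = trans (sumL-filter p xs h) (sym (ℤₚ.+-identityˡ _))

sumL-applyUpTo : (f : ℕ → A) (n : ℕ) (h : A → ℤ) →
  sumL (applyUpTo f n) h ≡ sumL (upTo n) (h ∘ f)
sumL-applyUpTo f n h = trans (go f n h) (sym (go id n (h ∘ f)))
  where
  -- The tail of `applyUpTo f` is an `applyUpTo` of `f ∘ suc`, so both sides are unrolled to a sum
  -- that no longer mentions a list.
  sumTo : ℕ → (ℕ → ℤ) → ℤ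
  sumTo zero p = 0ℤ
  sumTo (suc n) p = p 0 ⊕ sumTo n (p ∘ suc)
  go : ∀ {A : Set} (f : ℕ → A) n (h : A → ℤ) → sumL (applyUpTo f n) h ≡ sumTo n (h ∘ f)
  go f zero h = refl
  go f (suc n) h = cong (h (f 0) ⊕_) (go (f ∘ suc) n h)

sumL-upTo-suc : (n : ℕ) (h : ℕ → ℤ) → sumL (upTo (suc n)) h ≡ h 0 ⊕ sumL (upTo n) (h ∘ suc)
sumL-upTo-suc n h = cong (h 0 ⊕_) (sumL-applyUpTo suc n h)

sumV : List A → (r : ℕ) → (Vec A r → ℤ) → ℤ
sumV xs zero h = h []
sumV xs (suc r) h = sumL xs (λ x → sumV xs r (λ v → h (x ∷ v)))

sumV-linear : (xs : List A) (r : ℕ) → Linear (sumV xs r)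
sumV-linear xs zero = point-linear []
sumV-linear xs (suc r) =
  bind-linear (sumL-linear xs) (λ x → pull-linear (x ∷_) (sumV-linear xs r))

sumL-listsOf : (r : ℕ) (xs : List A) (h : List A → ℤ) →
  sumL (listsOf r xs) h ≡ sumV xs r (h ∘ toList)
sumL-listsOf zero xs h = ℤₚ.+-identityʳ (h [])
sumL-listsOf (suc r) xs h = begin
  sumL (concatMap (λ x → map (x ∷_) (listsOf r xs)) xs) h
    ≡⟨ sumL-concatMap (λ x → map (x ∷_) (listsOf r xs)) xs h ⟩
  sumL xs (λ x → sumL (map (x ∷_) (listsOf r xs)) h)
    ≡⟨ ext (sumL-linear xs) (λ x → trans (sumL-map (x ∷_) (listsOf r xs) h)
                                         (sumL-listsOf r xs (h ∘ (x ∷_)))) ⟩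
  sumL xs (λ x → sumV xs r (λ v → h (x ∷ toList v))) ∎

-- Peeling an empty bottom row or the first column off a shape.

bits : List Bool
bits = true ∷ false ∷ []

sumL-rowsUpTo-suc : (b : ℕ) (h : List Bool → ℤ) →
  sumL (rowsUpTo (suc b)) h ≡ h [] ⊕ sumL bits (λ x → sumL (rowsUpTo b) (λ row → h (x ∷ row)))
sumL-rowsUpTo-suc b h = begin
  sumL (rowsUpTo (suc b)) h
    ≡⟨ sumL-concatMap (λ k → listsOf k bits) (upTo (suc (suc b))) h ⟩
  sumL (upTo (suc (suc b))) (λ k → sumL (listsOf k bits) h)
    ≡⟨ sumL-upTo-suc (suc b) (λ k → sumL (listsOf k bits) h) ⟩
  (h [] ⊕ 0ℤ) ⊕ sumL (upTo (suc b)) (λ k → sumL (listsOf (suc k) bits) h)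
    ≡⟨ cong₂ _⊕_ (ℤₚ.+-identityʳ (h [])) (ext (sumL-linear (upTo (suc b))) split) ⟩
  h [] ⊕ sumL (upTo (suc b)) (λ k → sumL bits (λ x → sumL (listsOf k bits) (λ row → h (x ∷ row))))
    ≡⟨ cong (h [] ⊕_) (sumL-swap (sumL-linear bits) (upTo (suc b))
         (λ k x → sumL (listsOf k bits) (λ row → h (x ∷ row)))) ⟩
  h [] ⊕ sumL bits (λ x → sumL (upTo (suc b)) (λ k → sumL (listsOf k bits) (λ row → h (x ∷ row))))
    ≡⟨ cong (h [] ⊕_) (ext (sumL-linear bits)
         (λ x → sumL-concatMap (λ k → listsOf k bits) (upTo (suc b)) (h ∘ (x ∷_)))) ⟨
  h [] ⊕ sumL bits (λ x → sumL (rowsUpTo b) (λ row → h (x ∷ row))) ∎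
  where
  split : ∀ k → sumL (listsOf (suc k) bits) h
              ≡ sumL bits (λ x → sumL (listsOf k bits) (λ row → h (x ∷ row)))
  split k = trans (sumL-concatMap (λ x → map (x ∷_) (listsOf k bits)) bits h)
                  (ext (sumL-linear bits) (λ x → sumL-map (x ∷_) (listsOf k bits) h))

decreasing-tail : ∀ x F → decreasing F ≡ false → decreasing (x ∷ F) ≡ false
decreasing-tail x (y ∷ F) p = trans (cong ((length y ≤ᵇ length x) ∧_) p) (∧-zeroʳ _)

-- A Ferrers shape either ends in an empty row or has a full-height first column.
sumV-rows-split : (b r : ℕ) (h : Vec (List Bool) (suc r) → ℤ) →
  (∀ F → decreasing (toList F) ≡ false → h F ≡ 0ℤ) →
  sumV (rowsUpTo (suc b)) (suc r) h
  ≡ sumV (rowsUpTo (suc b)) r (λ F → h (F ▹ []))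
  ⊕ sumV bits (suc r) (λ col → sumV (rowsUpTo b) (suc r) (λ F → h (zipWith _∷_ col F)))
sumV-rows-split b zero h _ = sumL-rowsUpTo-suc b (λ row → h (row ∷ []))
sumV-rows-split b (suc r) h vanish = begin
  sumL (rowsUpTo (suc b)) (λ x → S (suc r) (λ F → h (x ∷ F)))
    ≡⟨ sumL-rowsUpTo-suc b (λ x → S (suc r) (λ F → h (x ∷ F))) ⟩
  S (suc r) (λ F → h ([] ∷ F)) ⊕ sumL bits (λ y → R (λ x → S (suc r) (λ F → h ((y ∷ x) ∷ F))))
    ≡⟨ cong₂ _⊕_ topEmpty topNonempty ⟩
  S r (λ F → h ([] ∷ F ▹ []))
  ⊕ (sumL bits (λ y → R (λ x → S r (λ F → h ((y ∷ x) ∷ F ▹ []))))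
     ⊕ V (suc (suc r)) h)
    ≡⟨ ℤₚ.+-assoc (S r (λ F → h ([] ∷ F ▹ []))) _ _ ⟨
  (S r (λ F → h ([] ∷ F ▹ []))
   ⊕ sumL bits (λ y → R (λ x → S r (λ F → h ((y ∷ x) ∷ F ▹ [])))))
  ⊕ V (suc (suc r)) h
    ≡⟨ cong (_⊕ V (suc (suc r)) h)
         (sumL-rowsUpTo-suc b (λ x → S r (λ F → h (x ∷ F ▹ [])))) ⟨
  S (suc r) (λ F → h (F ▹ [])) ⊕ V (suc (suc r)) h ∎
  where
  S = sumV (rowsUpTo (suc b))
  R = sumL (rowsUpTo b)
  V : (k : ℕ) → (Vec (List Bool) k → ℤ) → ℤ
  V k g = sumV bits k (λ col → sumV (rowsUpTo b) k (λ F → g (zipWith _∷_ col F)))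

  vanish-∷ : ∀ x F → decreasing (toList F) ≡ false → h (x ∷ F) ≡ 0ℤ
  vanish-∷ x F p = vanish (x ∷ F) (decreasing-tail x (toList F) p)

  -- An empty row above a nonempty one is no Ferrers shape, so under an empty top row only the
  -- branch with an empty bottom row survives.
  vanish-[] : ∀ col F → h ([] ∷ zipWith _∷_ col F) ≡ 0ℤ
  vanish-[] (y ∷ col) (x ∷ F) = vanish _ refl

  topEmpty : S (suc r) (λ F → h ([] ∷ F)) ≡ S r (λ F → h ([] ∷ F ▹ []))
  topEmpty = begin
    S (suc r) (λ F → h ([] ∷ F))
      ≡⟨ sumV-rows-split b r (λ F → h ([] ∷ F)) (vanish-∷ []) ⟩
    S r (λ F → h ([] ∷ F ▹ [])) ⊕ V (suc r) (λ F → h ([] ∷ F))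
      ≡⟨ cong (S r (λ F → h ([] ∷ F ▹ [])) ⊕_)
           (null-ext (sumV-linear bits (suc r)) λ col →
             null-ext (sumV-linear (rowsUpTo b) (suc r)) (vanish-[] col)) ⟩
    S r (λ F → h ([] ∷ F ▹ [])) ⊕ 0ℤ
      ≡⟨ ℤₚ.+-identityʳ _ ⟩
    S r (λ F → h ([] ∷ F ▹ [])) ∎

  inner : ∀ y → R (λ x → S (suc r) (λ F → h ((y ∷ x) ∷ F)))
              ≡ R (λ x → S r (λ F → h ((y ∷ x) ∷ F ▹ [])))
              ⊕ sumV bits (suc r) (λ col → R (λ x → sumV (rowsUpTo b) (suc r)
                  (λ F → h ((y ∷ x) ∷ zipWith _∷_ col F))))
  inner y = begin
    R (λ x → S (suc r) (λ F → h ((y ∷ x) ∷ F)))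
      ≡⟨ ext (sumL-linear (rowsUpTo b)) (λ x →
           sumV-rows-split b r (λ F → h ((y ∷ x) ∷ F)) (vanish-∷ (y ∷ x))) ⟩
    R (λ x → S r (λ F → h ((y ∷ x) ∷ F ▹ [])) ⊕ V (suc r) (λ F → h ((y ∷ x) ∷ F)))
      ≡⟨ add (sumL-linear (rowsUpTo b))
           (λ x → S r (λ F → h ((y ∷ x) ∷ F ▹ []))) (λ x → V (suc r) (λ F → h ((y ∷ x) ∷ F))) ⟩
    R (λ x → S r (λ F → h ((y ∷ x) ∷ F ▹ []))) ⊕ R (λ x → V (suc r) (λ F → h ((y ∷ x) ∷ F)))
      ≡⟨ cong (R (λ x → S r (λ F → h ((y ∷ x) ∷ F ▹ []))) ⊕_)
           (sumL-swap (sumV-linear bits (suc r)) (rowsUpTo b)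
             (λ x col → sumV (rowsUpTo b) (suc r) (λ F → h ((y ∷ x) ∷ zipWith _∷_ col F)))) ⟩
    _ ∎

  topNonempty : sumL bits (λ y → R (λ x → S (suc r) (λ F → h ((y ∷ x) ∷ F))))
              ≡ sumL bits (λ y → R (λ x → S r (λ F → h ((y ∷ x) ∷ F ▹ []))))
              ⊕ V (suc (suc r)) h
  topNonempty = trans (ext (sumL-linear bits) inner) (add (sumL-linear bits)
    (λ y → R (λ x → S r (λ F → h ((y ∷ x) ∷ F ▹ []))))
    (λ y → sumV bits (suc r) (λ col → R (λ x → sumV (rowsUpTo b) (suc r)
             (λ F → h ((y ∷ x) ∷ zipWith _∷_ col F))))))

-- Weights of columns

Row : Set
Row = List Bool

Cell : Set
Cell = Maybe Bool × Bool

sgn : Bool → ℤ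
sgn b = if b then 1ℤ else -1ℤ

anyTo allTo : ℕ → (ℕ → Bool) → Bool
anyTo zero p = false
anyTo (suc n) p = p 0 ∨ anyTo n (p ∘ suc)
allTo zero p = true
allTo (suc n) p = p 0 ∧ allTo n (p ∘ suc)

prodTo : ℕ → (ℕ → ℤ) → ℤ
prodTo zero p = 1ℤ
prodTo (suc n) p = p 0 * prodTo n (p ∘ suc)

isOne isZero : Maybe Bool → Bool
isOne (just true) = true
isOne _ = false
isZero (just false) = true
isZero _ = false

-- A cell carries its entry (nothing outside the shape) and whether a 1 stands to its left.
-- κ≥ weighs the part of a column below its topmost 1; κ weighs a column without a 1 so far,
-- its flag recording a column-restricted 0 above.
κ≥ : Vec Cell r → ℤ
κ≥ [] = 1ℤ
κ≥ ((just false , true) ∷ cs) = 0ℤ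
κ≥ (_ ∷ cs) = κ≥ cs

κ : Bool → Vec Cell r → ℤ
κ b [] = 0ℤ
κ b ((just true , _) ∷ cs) = sgn b * κ≥ cs
κ b ((just false , l) ∷ cs) = κ (b ∨ l) cs
κ b ((nothing , _) ∷ cs) = κ b cs

cell : ℕ → Bool → Row → Cell
cell j x row = row !? j , x ∨ anyTo j (λ k → isOne (row !? k))

-- The word w records which rows already contain a 1 to the left of the filling.
cells : Vec Bool r → Vec Row r → ℕ → Vec Cell r
cells w F j = zipWith (cell j) w F

-- Fillings of a wrong shape get weight zero instead of being excluded, which supplies the vanishing
-- hypothesis of `sumV-rows-split`.
weight : Vec Bool r → Vec Row r → ℕ → ℤ
weight {r} w F m =
  if decreasing (toList F) ∧ (r ℕ.+ numCols (toList F) ≡ᵇ m)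
  then prodTo (numCols (toList F)) (λ j → κ false (cells w F j)) else 0ℤ

prodTo-cong : ∀ n {p q : ℕ → ℤ} → (∀ j → p j ≡ q j) → prodTo n p ≡ prodTo n q
prodTo-cong zero e = refl
prodTo-cong (suc n) e = cong₂ _*_ (e 0) (prodTo-cong n (e ∘ suc))

anyTo-cong : ∀ n {p q : ℕ → Bool} → (∀ j → p j ≡ q j) → anyTo n p ≡ anyTo n q
anyTo-cong zero e = refl
anyTo-cong (suc n) e = cong₂ _∨_ (e 0) (anyTo-cong n (e ∘ suc))

allTo-cong : ∀ n {p q : ℕ → Bool} → (∀ j → p j ≡ q j) → allTo n p ≡ allTo n q
allTo-cong zero e = refl
allTo-cong (suc n) e = cong₂ _∧_ (e 0) (allTo-cong n (e ∘ suc))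

if-* : ∀ b (k x : ℤ) → (if b then k * x else 0ℤ) ≡ k * (if b then x else 0ℤ)
if-* true k x = refl
if-* false k x = sym (ℤₚ.*-zeroʳ k)

κ≥-∷ʳ : (w : Vec Bool r) (F : Vec Row r) (a : Bool) (j : ℕ) →
  κ≥ (cells (w ▹ a) (F ▹ []) j) ≡ κ≥ (cells w F j)
κ≥-∷ʳ [] [] a j = refl
κ≥-∷ʳ (x ∷ w) (row ∷ F) a j with row !? j | x ∨ anyTo j (λ k → isOne (row !? k))
... | nothing    | _     = κ≥-∷ʳ w F a j
... | just true  | _     = κ≥-∷ʳ w F a j
... | just false | true  = refl
... | just false | false = κ≥-∷ʳ w F a j

-- An empty bottom row only adds a cell outside the shape, which is ignored whatever its memory `a`.
κ-∷ʳ : (b : Bool) (w : Vec Bool r) (F : Vec Row r) (a : Bool) (j : ℕ) →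
  κ b (cells (w ▹ a) (F ▹ []) j) ≡ κ b (cells w F j)
κ-∷ʳ b [] [] a j = refl
κ-∷ʳ b (x ∷ w) (row ∷ F) a j with row !? j
... | nothing    = κ-∷ʳ b w F a j
... | just true  = cong (sgn b *_) (κ≥-∷ʳ w F a j)
... | just false = κ-∷ʳ (b ∨ (x ∨ anyTo j (λ k → isOne (row !? k)))) w F a j

numCols-∷ʳ : (F : Vec Row r) → numCols (toList (F ▹ [])) ≡ numCols (toList F)
numCols-∷ʳ [] = refl
numCols-∷ʳ (x ∷ F) = refl

decreasing-∷ʳ : (F : Vec Row r) → decreasing (toList (F ▹ [])) ≡ decreasing (toList F)
decreasing-∷ʳ [] = refl
decreasing-∷ʳ (x ∷ []) = refl
decreasing-∷ʳ (x ∷ y ∷ F) = cong ((length y ≤ᵇ length x) ∧_) (decreasing-∷ʳ (y ∷ F))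

weight-∷ʳ : (w : Vec Bool r) (a : Bool) (F : Vec Row r) (m : ℕ) →
  weight (w ▹ a) (F ▹ []) (suc m) ≡ weight w F m
weight-∷ʳ w a F m
  rewrite decreasing-∷ʳ F | numCols-∷ʳ F
        | prodTo-cong (numCols (toList F)) (κ-∷ʳ false w F a) = refl

suc-≤ᵇ-suc : ∀ m n → (suc m ≤ᵇ suc n) ≡ (m ≤ᵇ n)
suc-≤ᵇ-suc zero n = refl
suc-≤ᵇ-suc (suc m) n = refl

decreasing-zipWith-∷ : (col : Vec Bool r) (F : Vec Row r) →
  decreasing (toList (zipWith _∷_ col F)) ≡ decreasing (toList F)
decreasing-zipWith-∷ [] [] = refl
decreasing-zipWith-∷ (c ∷ []) (x ∷ []) = refl
decreasing-zipWith-∷ (c ∷ c' ∷ col) (x ∷ y ∷ F) =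
  cong₂ _∧_ (suc-≤ᵇ-suc (length y) (length x)) (decreasing-zipWith-∷ (c' ∷ col) (y ∷ F))

isOne-just : ∀ c → isOne (just c) ≡ c
isOne-just true = refl
isOne-just false = refl

-- The deleted column moves into the memory, by associativity of `_∨_`.
cells-suc : (w col : Vec Bool r) (F : Vec Row r) (j : ℕ) →
  cells w (zipWith _∷_ col F) (suc j) ≡ cells (zipWith _∨_ w col) F j
cells-suc [] [] [] j = refl
cells-suc (x ∷ w) (c ∷ col) (row ∷ F) j = cong₂ _∷_ (cong (row !? j ,_) left) (cells-suc w col F j)
  where
  left : x ∨ (isOne (just c) ∨ anyTo j (λ k → isOne (row !? k)))
       ≡ (x ∨ c) ∨ anyTo j (λ k → isOne (row !? k))
  left rewrite isOne-just c = sym (∨-assoc x c _)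

firstCells : Vec Bool r → Vec Bool r → Vec Cell r
firstCells = zipWith (λ x c → just c , x)

cells-zero : (w col : Vec Bool r) (F : Vec Row r) →
  cells w (zipWith _∷_ col F) 0 ≡ firstCells w col
cells-zero [] [] [] = refl
cells-zero (x ∷ w) (c ∷ col) (row ∷ F) =
  cong₂ _∷_ (cong (just c ,_) (∨-identityʳ x)) (cells-zero w col F)

-- The first cells see only `w` and `col`, later cells only the updated memory, so the column splits
-- off as a factor. With no rows `numCols` would stay 0 and the column would go uncounted, hence
-- `suc r`.
weight-zipWith-∷ : (w col : Vec Bool (suc r)) (F : Vec Row (suc r)) (m : ℕ) →
  weight w (zipWith _∷_ col F) (suc m)
  ≡ κ false (firstCells w col) * weight (zipWith _∨_ w col) F m
weight-zipWith-∷ {r} w@(_ ∷ _) col@(_ ∷ _) F@(row ∷ _) m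
  rewrite decreasing-zipWith-∷ col F
        | ℕₚ.+-suc r (length row)
        | cells-zero w col F
        | prodTo-cong (length row) (λ j → cong (κ false) (cells-suc w col F j))
  = if-* (decreasing (toList F) ∧ (suc (r ℕ.+ length row) ≡ᵇ m)) (κ false (firstCells w col)) _

-- Transfer operators

-- colC sums over the possible columns to the right of the word w, and colE over the parts of a
-- column below its topmost 1 (a row with a 1 to its left then has no choice).
colE : (Vec Bool r → ℤ) → Vec Bool r → ℤ
colE g [] = g []
colE g (false ∷ w) = colE (g ∘ (false ∷_)) w ⊕ colE (g ∘ (true ∷_)) w
colE g (true ∷ w) = colE (g ∘ (true ∷_)) w

colC : Bool → (Vec Bool r → ℤ) → Vec Bool r → ℤ
colC b g [] = 0ℤ
colC b g (x ∷ w) = colC (b ∨ x) (g ∘ (x ∷_)) w ⊕ sgn b * colE (g ∘ (true ∷_)) w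

colE-linear : (w : Vec Bool r) → Linear (λ g → colE g w)
colE-linear [] = point-linear []
colE-linear (false ∷ w) = +-linear (pull-linear _ (colE-linear w)) (pull-linear _ (colE-linear w))
colE-linear (true ∷ w) = pull-linear _ (colE-linear w)

colC-linear : (b : Bool) (w : Vec Bool r) → Linear (λ g → colC b g w)
colC-linear b [] = zero-linear
colC-linear b (x ∷ w) =
  +-linear (pull-linear _ (colC-linear (b ∨ x) w)) (*-linear (sgn b) (pull-linear _ (colE-linear w)))

sum-κ≥ : (w : Vec Bool r) (g : Vec Bool r → ℤ) →
  sumV bits r (λ col → κ≥ (firstCells w col) * g (zipWith _∨_ w col)) ≡ colE g w
sum-κ≥ [] g = ℤₚ.*-identityˡ (g [])
sum-κ≥ (false ∷ w) g
  rewrite sum-κ≥ w (g ∘ (true ∷_)) | sum-κ≥ w (g ∘ (false ∷_)) =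
  comm (colE (g ∘ (true ∷_)) w) (colE (g ∘ (false ∷_)) w)
  where
  comm : ∀ x y → x ⊕ (y ⊕ 0ℤ) ≡ y ⊕ x
  comm = solve-∀
-- A 0 here has a 1 above and a 1 to its left, so its weight is zero and only the entry 1 survives.
sum-κ≥ {suc r} (true ∷ w) g
  rewrite sum-κ≥ w (g ∘ (true ∷_)) | null (sumV-linear bits r) = ℤₚ.+-identityʳ _

-- Split on the top entry: a 1 is the topmost 1, fixes the sign and leaves the rest to `colE`; a 0
-- raises the flag if its row already has a 1.
sum-κ : (b : Bool) (w : Vec Bool r) (g : Vec Bool r → ℤ) →
  sumV bits r (λ col → κ b (firstCells w col) * g (zipWith _∨_ w col)) ≡ colC b g w
sum-κ b [] g = refl
sum-κ {suc r} b (x ∷ w) g = begin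
  sumV bits r (λ col → sgn b * κ≥ (firstCells w col) * g ((x ∨ true) ∷ zipWith _∨_ w col))
  ⊕ (sumV bits r (λ col → κ (b ∨ x) (firstCells w col) * g ((x ∨ false) ∷ zipWith _∨_ w col)) ⊕ 0ℤ)
    ≡⟨ cong₂ (λ y z → y ⊕ (z ⊕ 0ℤ)) first rest ⟩
  sgn b * colE (g ∘ (true ∷_)) w ⊕ (colC (b ∨ x) (g ∘ (x ∷_)) w ⊕ 0ℤ)
    ≡⟨ comm _ (colC (b ∨ x) (g ∘ (x ∷_)) w) ⟩
  colC (b ∨ x) (g ∘ (x ∷_)) w ⊕ sgn b * colE (g ∘ (true ∷_)) w ∎
  where
  comm : ∀ x y → x ⊕ (y ⊕ 0ℤ) ≡ y ⊕ x
  comm = solve-∀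
  first : sumV bits r (λ col → sgn b * κ≥ (firstCells w col) * g ((x ∨ true) ∷ zipWith _∨_ w col))
        ≡ sgn b * colE (g ∘ (true ∷_)) w
  first = begin
    _ ≡⟨ ext (sumV-linear bits r) (λ col → trans (ℤₚ.*-assoc (sgn b) _ _)
           (cong (λ y → sgn b * (κ≥ (firstCells w col) * g (y ∷ zipWith _∨_ w col))) (∨-zeroʳ x))) ⟩
    _ ≡⟨ scale (sumV-linear bits r) (sgn b) _ ⟩
    _ ≡⟨ cong (sgn b *_) (sum-κ≥ w (g ∘ (true ∷_))) ⟩
    _ ∎
  rest : sumV bits r (λ col → κ (b ∨ x) (firstCells w col) * g ((x ∨ false) ∷ zipWith _∨_ w col))
       ≡ colC (b ∨ x) (g ∘ (x ∷_)) w
  rest rewrite ∨-identityʳ x = sum-κ (b ∨ x) w (g ∘ (x ∷_))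

-- The transposed operators act on words of row functionals: true is the functional that is
-- constantly 1, false the indicator of a row without a 1 to its left.

Word : Set
Word = List Bool

-- Words of different lengths pair to 0, so a single sum over words serves every number of rows.
ev : Word → Vec Bool r → ℤ
ev [] [] = 1ℤ
ev [] (_ ∷ _) = 0ℤ
ev (_ ∷ _) [] = 0ℤ
ev (true ∷ c) (_ ∷ w) = ev c w
ev (false ∷ c) (false ∷ w) = ev c w
ev (false ∷ c) (true ∷ w) = 0ℤ

-- Eᵀ fills the cells below a topmost 1 and Dᵀ sums over all positions of the topmost 1; Uᵀ is
-- Dᵀ restricted to unrestricted columns, so that the rows above the topmost 1 turn into false.
Eᵀ Dᵀ Uᵀ Cᵀ : (Word → ℤ) → Word → ℤ
Eᵀ G [] = G []
Eᵀ G (true ∷ c) = Eᵀ (G ∘ (true ∷_)) c ⊕ Eᵀ (G ∘ (false ∷_)) c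
Eᵀ G (false ∷ c) = Eᵀ (G ∘ (false ∷_)) c
Dᵀ G [] = 0ℤ
Dᵀ G (true ∷ c) = Eᵀ (G ∘ (true ∷_)) c ⊕ Dᵀ (G ∘ (true ∷_)) c
Dᵀ G (false ∷ c) = Dᵀ (G ∘ (false ∷_)) c
Uᵀ G [] = 0ℤ
Uᵀ G (true ∷ c) = Eᵀ (G ∘ (true ∷_)) c ⊕ Uᵀ (G ∘ (false ∷_)) c
Uᵀ G (false ∷ c) = Uᵀ (G ∘ (false ∷_)) c
-- (-1)^[unrestricted] = 1 - 2[unrestricted].
Cᵀ G c = Dᵀ G c ⊕ - + 2 * Uᵀ G c

Eᵀ-linear : ∀ c → Linear (λ G → Eᵀ G c)
Eᵀ-linear [] = point-linear []
Eᵀ-linear (true ∷ c) = +-linear (pull-linear _ (Eᵀ-linear c)) (pull-linear _ (Eᵀ-linear c))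
Eᵀ-linear (false ∷ c) = pull-linear _ (Eᵀ-linear c)

Dᵀ-linear : ∀ c → Linear (λ G → Dᵀ G c)
Dᵀ-linear [] = zero-linear
Dᵀ-linear (true ∷ c) = +-linear (pull-linear _ (Eᵀ-linear c)) (pull-linear _ (Dᵀ-linear c))
Dᵀ-linear (false ∷ c) = pull-linear _ (Dᵀ-linear c)

Uᵀ-linear : ∀ c → Linear (λ G → Uᵀ G c)
Uᵀ-linear [] = zero-linear
Uᵀ-linear (true ∷ c) = +-linear (pull-linear _ (Eᵀ-linear c)) (pull-linear _ (Uᵀ-linear c))
Uᵀ-linear (false ∷ c) = pull-linear _ (Uᵀ-linear c)

Cᵀ-linear : ∀ c → Linear (λ G → Cᵀ G c)
Cᵀ-linear c = +-linear (Dᵀ-linear c) (*-linear (- + 2) (Uᵀ-linear c))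

-- Row by row: below the topmost 1 a row without an earlier 1 has two possible entries, any other
-- row one, so the constant functional pulls back to itself plus the indicator. The indicator forces
-- the entry 0 and pulls back to itself.
colE-ev : (c : Word) (w : Vec Bool r) → colE (ev c) w ≡ Eᵀ (λ c' → ev c' w) c
colE-ev [] [] = refl
colE-ev [] (false ∷ w) rewrite null (colE-linear w) = refl
colE-ev [] (true ∷ w) = null (colE-linear w)
colE-ev (true ∷ c) [] rewrite null (Eᵀ-linear c) = refl
colE-ev (false ∷ c) [] = sym (null (Eᵀ-linear c))
colE-ev (true ∷ c) (false ∷ w) = cong₂ _⊕_ (colE-ev c w) (colE-ev c w)
colE-ev (true ∷ c) (true ∷ w) rewrite null (Eᵀ-linear c) =
  trans (colE-ev c w) (sym (ℤₚ.+-identityʳ _))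
colE-ev (false ∷ c) (false ∷ w) rewrite null (colE-linear w) =
  trans (ℤₚ.+-identityʳ _) (colE-ev c w)
colE-ev (false ∷ c) (true ∷ w) = trans (null (colE-linear w)) (sym (null (Eᵀ-linear c)))

-- Once the flag is up every sign is +1 and a plain count remains. The topmost 1 cannot lie in a row
-- with functional `false`.
colC-true-ev : (c : Word) (w : Vec Bool r) → colC true (ev c) w ≡ Dᵀ (λ c' → ev c' w) c
colC-true-ev [] [] = refl
colC-true-ev [] (x ∷ w) rewrite null (colC-linear true w) | null (colE-linear w) = refl
colC-true-ev (true ∷ c) [] rewrite null (Eᵀ-linear c) | null (Dᵀ-linear c) = refl
colC-true-ev (false ∷ c) [] = sym (null (Dᵀ-linear c))
colC-true-ev (true ∷ c) (x ∷ w) rewrite colC-true-ev c w | colE-ev c w =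
  comm (Eᵀ (λ c' → ev c' w) c) (Dᵀ (λ c' → ev c' w) c)
  where
  comm : ∀ x y → y ⊕ 1ℤ * x ≡ x ⊕ y
  comm = solve-∀
colC-true-ev (false ∷ c) (false ∷ w) rewrite null (colE-linear w) =
  trans (ℤₚ.+-identityʳ _) (colC-true-ev c w)
colC-true-ev (false ∷ c) (true ∷ w)
  rewrite null (colC-linear true w) | null (colE-linear w) = sym (null (Dᵀ-linear c))

colC-ev : (c : Word) (w : Vec Bool r) → colC false (ev c) w ≡ Cᵀ (λ c' → ev c' w) c
colC-ev [] [] = refl
colC-ev [] (x ∷ w) rewrite null (colC-linear x w) | null (colE-linear w) = refl
colC-ev (true ∷ c) [] rewrite null (Eᵀ-linear c) | null (Dᵀ-linear c) | null (Uᵀ-linear c) = refl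
colC-ev (false ∷ c) [] rewrite null (Dᵀ-linear c) | null (Uᵀ-linear c) = refl
colC-ev (true ∷ c) (false ∷ w) rewrite colC-ev c w | colE-ev c w =
  eq (Eᵀ (λ c' → ev c' w) c) (Dᵀ (λ c' → ev c' w) c) (Uᵀ (λ c' → ev c' w) c)
  where
  eq : ∀ e d u → (d ⊕ - + 2 * u) ⊕ -1ℤ * e ≡ (e ⊕ d) ⊕ - + 2 * (e ⊕ u)
  eq = solve-∀
-- Skipping this row leaves a column-restricted 0, so the flag goes up and the plain count takes
-- over. In `Uᵀ` the skipped row becomes `false`, which evaluates to 0 on a row with a 1.
colC-ev (true ∷ c) (true ∷ w) rewrite colC-true-ev c w | colE-ev c w | null (Uᵀ-linear c) =
  eq (Eᵀ (λ c' → ev c' w) c) (Dᵀ (λ c' → ev c' w) c)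
  where
  eq : ∀ e d → d ⊕ -1ℤ * e ≡ (e ⊕ d) ⊕ - + 2 * (e ⊕ 0ℤ)
  eq = solve-∀
colC-ev (false ∷ c) (false ∷ w) rewrite null (colE-linear w) =
  trans (ℤₚ.+-identityʳ _) (colC-ev c w)
colC-ev (false ∷ c) (true ∷ w)
  rewrite null (colC-linear true w) | null (colE-linear w)
        | null (Dᵀ-linear c) | null (Uᵀ-linear c) = refl

-- I m G is the signed sum of G over the states reached from the empty one in m steps, a step
-- appending a free row or inserting a column on the left.
I : ℕ → (Word → ℤ) → ℤ
I zero G = G []
I (suc m) G = I m (λ c → G (c ∷ʳ true) ⊕ Cᵀ G c)

I-linear : ∀ m → Linear (I m)
I-linear zero = point-linear []
I-linear (suc m) = bind-linear (I-linear m) (λ c → +-linear (point-linear (c ∷ʳ true)) (Cᵀ-linear c))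

ev-∷ʳ-[] : ∀ c → ev (c ∷ʳ true) [] ≡ 0ℤ
ev-∷ʳ-[] [] = refl
ev-∷ʳ-[] (x ∷ c) = refl

-- The appended functional is constantly 1, so the memory of the last row is forgotten.
ev-∷ʳ : (c : Word) (w : Vec Bool r) (a : Bool) → ev (c ∷ʳ true) (w ▹ a) ≡ ev c w
ev-∷ʳ [] [] a = refl
ev-∷ʳ [] (x ∷ []) a = refl
ev-∷ʳ [] (x ∷ y ∷ w) a = refl
ev-∷ʳ (true ∷ c) [] a = ev-∷ʳ-[] c
ev-∷ʳ (false ∷ c) [] true = refl
ev-∷ʳ (false ∷ c) [] false = ev-∷ʳ-[] c
ev-∷ʳ (true ∷ c) (x ∷ w) a = ev-∷ʳ c w a
ev-∷ʳ (false ∷ c) (true ∷ w) a = refl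
ev-∷ʳ (false ∷ c) (false ∷ w) a = ev-∷ʳ c w a

colE-swap : {φ : (A → ℤ) → ℤ} → Linear φ → (w : Vec Bool r) (G : A → Vec Bool r → ℤ) →
  colE (λ v → φ (λ c → G c v)) w ≡ φ (λ c → colE (G c) w)
colE-swap L [] G = refl
colE-swap L (false ∷ w) G = trans
  (cong₂ _⊕_ (colE-swap L w (λ c → G c ∘ (false ∷_))) (colE-swap L w (λ c → G c ∘ (true ∷_))))
  (sym (add L _ _))
colE-swap L (true ∷ w) G = colE-swap L w (λ c → G c ∘ (true ∷_))

colC-swap : {φ : (A → ℤ) → ℤ} → Linear φ → (b : Bool) (w : Vec Bool r) (G : A → Vec Bool r → ℤ) →
  colC b (λ v → φ (λ c → G c v)) w ≡ φ (λ c → colC b (G c) w)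
colC-swap L b [] G = sym (null L)
colC-swap {φ = φ} L b (x ∷ w) G = begin
  colC (b ∨ x) (λ v → φ (λ c → G c (x ∷ v))) w ⊕ sgn b * colE (λ v → φ (λ c → G c (true ∷ v))) w
    ≡⟨ cong₂ (λ y z → y ⊕ sgn b * z) (colC-swap L (b ∨ x) w (λ c → G c ∘ (x ∷_)))
                                     (colE-swap L w (λ c → G c ∘ (true ∷_))) ⟩
  φ G₁ ⊕ sgn b * φ G₂
    ≡⟨ cong (φ G₁ ⊕_) (scale L (sgn b) G₂) ⟨
  φ G₁ ⊕ φ (λ c → sgn b * G₂ c)
    ≡⟨ add L G₁ (λ c → sgn b * G₂ c) ⟨
  φ (λ c → G₁ c ⊕ sgn b * G₂ c) ∎
  where
  G₁ G₂ : _ → ℤ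
  G₁ c = colC (b ∨ x) (G c ∘ (x ∷_)) w
  G₂ c = colE (G c ∘ (true ∷_)) w

-- Induction on `m` along `sumV-rows-split`: the bottom-row branch becomes an appended free row, the
-- column branch becomes `Cᵀ` by transposition. The bound `b` drops only with a column, so an
-- inequality is carried.
sumV-weight : ∀ m b (w : Vec Bool r) → m ≤ b →
  sumV (rowsUpTo b) r (λ F → weight w F m) ≡ I m (λ c → ev c w)
sumV-weight zero b [] _ = refl
sumV-weight {suc r} zero b w@(_ ∷ _) _ = null-ext (sumV-linear (rowsUpTo b) (suc r)) vanish
  where
  vanish : ∀ F → weight w F zero ≡ 0ℤ
  vanish F rewrite ∧-zeroʳ (decreasing (toList F)) = refl
-- Without rows there are no columns, so no positive length occurs. Dually, an appended row does not
-- match the empty word, and a column without cells has no 1.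
sumV-weight (suc m) (suc b) [] _ =
  sym (null-ext (I-linear m) (λ c → cong₂ _⊕_ (ev-∷ʳ-[] c) (sym (colC-ev c []))))
-- This exposes the memory of the bottom row, the one that may be empty and deleted.
sumV-weight {suc r} (suc m) (suc b) w (s≤s m≤b) with initLast w
... | w' , a , refl = begin
  sumV (rowsUpTo (suc b)) (suc r) (λ F → weight w F (suc m))
    ≡⟨ sumV-rows-split b r (λ F → weight w F (suc m)) vanish ⟩
  sumV (rowsUpTo (suc b)) r (λ F → weight w (F ▹ []) (suc m))
  ⊕ sumV bits (suc r) (λ col → sumV (rowsUpTo b) (suc r) (λ F → weight w (zipWith _∷_ col F) (suc m)))
    ≡⟨ cong₂ _⊕_ dropRow dropColumn ⟩
  I m (λ c → ev (c ∷ʳ true) w) ⊕ I m (λ c → Cᵀ (λ c' → ev c' w) c)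
    ≡⟨ add (I-linear m) _ _ ⟨
  I (suc m) (λ c → ev c w) ∎
  where
  vanish : ∀ F → decreasing (toList F) ≡ false → weight w F (suc m) ≡ 0ℤ
  vanish F p rewrite p = refl

  dropRow : sumV (rowsUpTo (suc b)) r (λ F → weight w (F ▹ []) (suc m))
          ≡ I m (λ c → ev (c ∷ʳ true) w)
  dropRow = begin
    sumV (rowsUpTo (suc b)) r (λ F → weight w (F ▹ []) (suc m))
      ≡⟨ ext (sumV-linear (rowsUpTo (suc b)) r) (λ F → weight-∷ʳ w' a F m) ⟩
    sumV (rowsUpTo (suc b)) r (λ F → weight w' F m)
      ≡⟨ sumV-weight m (suc b) w' (ℕₚ.m≤n⇒m≤1+n m≤b) ⟩
    I m (λ c → ev c w')
      ≡⟨ ext (I-linear m) (λ c → ev-∷ʳ c w' a) ⟨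
    I m (λ c → ev (c ∷ʳ true) w) ∎

  column : ∀ col → sumV (rowsUpTo b) (suc r) (λ F → weight w (zipWith _∷_ col F) (suc m))
                 ≡ κ false (firstCells w col) * I m (λ c → ev c (zipWith _∨_ w col))
  column col = begin
    sumV (rowsUpTo b) (suc r) (λ F → weight w (zipWith _∷_ col F) (suc m))
      ≡⟨ ext (sumV-linear (rowsUpTo b) (suc r)) (λ F → weight-zipWith-∷ w col F m) ⟩
    sumV (rowsUpTo b) (suc r) (λ F → κ false (firstCells w col) * weight (zipWith _∨_ w col) F m)
      ≡⟨ scale (sumV-linear (rowsUpTo b) (suc r)) (κ false (firstCells w col))
           (λ F → weight (zipWith _∨_ w col) F m) ⟩
    κ false (firstCells w col) * sumV (rowsUpTo b) (suc r) (λ F → weight (zipWith _∨_ w col) F m)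
      ≡⟨ cong (κ false (firstCells w col) *_) (sumV-weight m b (zipWith _∨_ w col) m≤b) ⟩
    κ false (firstCells w col) * I m (λ c → ev c (zipWith _∨_ w col)) ∎

  dropColumn : sumV bits (suc r) (λ col →
                 sumV (rowsUpTo b) (suc r) (λ F → weight w (zipWith _∷_ col F) (suc m)))
             ≡ I m (λ c → Cᵀ (λ c' → ev c' w) c)
  dropColumn = begin
    _ ≡⟨ ext (sumV-linear bits (suc r)) column ⟩
    sumV bits (suc r) (λ col → κ false (firstCells w col) * I m (λ c → ev c (zipWith _∨_ w col)))
      ≡⟨ sum-κ false w (λ v → I m (λ c → ev c v)) ⟩
    colC false (λ v → I m (λ c → ev c v)) w
      ≡⟨ colC-swap (I-linear m) false w ev ⟩
    I m (λ c → colC false (ev c) w)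
      ≡⟨ ext (I-linear m) (λ c → colC-ev c w) ⟩
    I m (λ c → Cᵀ (λ c' → ev c' w) c) ∎

-- Summation over the number of rows

Eᵀ-ext : ∀ {G H} c → (∀ c' → length c' ≡ length c → G c' ≡ H c') → Eᵀ G c ≡ Eᵀ H c
Eᵀ-ext [] p = p [] refl
Eᵀ-ext (true ∷ c) p = cong₂ _⊕_ (Eᵀ-ext c (λ c' e → p _ (cong suc e)))
                                (Eᵀ-ext c (λ c' e → p _ (cong suc e)))
Eᵀ-ext (false ∷ c) p = Eᵀ-ext c (λ c' e → p _ (cong suc e))

Dᵀ-ext : ∀ {G H} c → (∀ c' → length c' ≡ length c → G c' ≡ H c') → Dᵀ G c ≡ Dᵀ H c
Dᵀ-ext [] p = refl
Dᵀ-ext (true ∷ c) p = cong₂ _⊕_ (Eᵀ-ext c (λ c' e → p _ (cong suc e)))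
                                (Dᵀ-ext c (λ c' e → p _ (cong suc e)))
Dᵀ-ext (false ∷ c) p = Dᵀ-ext c (λ c' e → p _ (cong suc e))

Uᵀ-ext : ∀ {G H} c → (∀ c' → length c' ≡ length c → G c' ≡ H c') → Uᵀ G c ≡ Uᵀ H c
Uᵀ-ext [] p = refl
Uᵀ-ext (true ∷ c) p = cong₂ _⊕_ (Eᵀ-ext c (λ c' e → p _ (cong suc e)))
                                (Uᵀ-ext c (λ c' e → p _ (cong suc e)))
Uᵀ-ext (false ∷ c) p = Uᵀ-ext c (λ c' e → p _ (cong suc e))

-- Each step appends one row or keeps the length, so only words of length at most `m` are reached.
-- The length bound is what `sum-ev` requires.
I-ext : ∀ m {G H} → (∀ c → length c ≤ m → G c ≡ H c) → I m G ≡ I m H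
I-ext zero p = p [] z≤n
I-ext (suc m) {G} {H} p = I-ext m step
  where
  step : ∀ c → length c ≤ m → G (c ∷ʳ true) ⊕ Cᵀ G c ≡ H (c ∷ʳ true) ⊕ Cᵀ H c
  step c l = cong₂ _⊕_
    (p _ (subst (_≤ suc m) (sym (trans (length-++ c) (ℕₚ.+-comm (length c) 1))) (s≤s l)))
    (cong₂ (λ x y → x ⊕ - + 2 * y) (Dᵀ-ext c p') (Uᵀ-ext c p'))
    where
    p' : ∀ c' → length c' ≡ length c → G c' ≡ H c'
    p' c' e = p c' (subst (_≤ suc m) (sym e) (ℕₚ.m≤n⇒m≤1+n l))

-- Only `r = length c` contributes, and there every row functional is 1 because no row has a 1 yet.
sum-ev : ∀ m c → length c ≤ m →
  sumL (upTo (suc m)) (λ r → ev c (replicate r false)) ≡ 1ℤ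
sum-ev m [] _ = begin
  sumL (upTo (suc m)) (λ r → ev [] (replicate r false))
    ≡⟨ sumL-upTo-suc m (λ r → ev [] (replicate r false)) ⟩
  1ℤ ⊕ sumL (upTo m) (λ _ → 0ℤ)
    ≡⟨ cong (1ℤ ⊕_) (null (sumL-linear (upTo m))) ⟩
  1ℤ ∎
sum-ev (suc m) c@(x ∷ c') (s≤s l) = begin
  sumL (upTo (suc (suc m))) (λ r → ev c (replicate r false))
    ≡⟨ sumL-upTo-suc (suc m) (λ r → ev c (replicate r false)) ⟩
  0ℤ ⊕ sumL (upTo (suc m)) (λ r → ev c (replicate (suc r) false))
    ≡⟨ ℤₚ.+-identityˡ _ ⟩
  sumL (upTo (suc m)) (λ r → ev c (replicate (suc r) false))
    ≡⟨ ext (sumL-linear (upTo (suc m))) (λ r → tail x (replicate r false)) ⟩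
  sumL (upTo (suc m)) (λ r → ev c' (replicate r false))
    ≡⟨ sum-ev m c' l ⟩
  1ℤ ∎
  where
  tail : ∀ {r} x (w : Vec Bool r) → ev (x ∷ c') (false ∷ w) ≡ ev c' w
  tail true w = refl
  tail false w = refl

-- Evaluation on powers indexed by the number of free rows.

power : ℤ → Word → ℤ
power u [] = 1ℤ
power u (true ∷ c) = u * power u c
power u (false ∷ c) = power u c

power-1 : ∀ c → power 1ℤ c ≡ 1ℤ
power-1 [] = refl
power-1 (true ∷ c) = trans (ℤₚ.*-identityˡ _) (power-1 c)
power-1 (false ∷ c) = power-1 c

power-∷ʳ : ∀ u c → power u (c ∷ʳ true) ≡ u * power u c
power-∷ʳ u [] = refl
power-∷ʳ u (true ∷ c) = cong (u *_) (power-∷ʳ u c)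
power-∷ʳ u (false ∷ c) = power-∷ʳ u c

-- Each free row either stays free or becomes `false`, a factor `u + 1`.
Eᵀ-power : ∀ u c → Eᵀ (power u) c ≡ power (1ℤ ⊕ u) c
Eᵀ-power u [] = refl
Eᵀ-power u (true ∷ c) rewrite scale (Eᵀ-linear c) u (power u) | Eᵀ-power u c =
  eq u (power (1ℤ ⊕ u) c)
  where
  eq : ∀ u x → u * x ⊕ x ≡ (1ℤ ⊕ u) * x
  eq = solve-∀
Eᵀ-power u (false ∷ c) = Eᵀ-power u c

-- With k free rows, a topmost 1 below i of them contributes u^(i+1) (1+u)^(k-1-i). This geometric
-- sum telescopes because 1+u and u differ by 1.
Dᵀ-power : ∀ u c → Dᵀ (power u) c ≡ u * (power (1ℤ ⊕ u) c - power u c)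
Dᵀ-power u [] = sym (ℤₚ.*-zeroʳ u)
Dᵀ-power u (true ∷ c)
  rewrite scale (Eᵀ-linear c) u (power u) | scale (Dᵀ-linear c) u (power u)
        | Eᵀ-power u c | Dᵀ-power u c = eq u (power (1ℤ ⊕ u) c) (power u c)
  where
  eq : ∀ u x y → u * x ⊕ u * (u * (x - y)) ≡ u * ((1ℤ ⊕ u) * x - u * y)
  eq = solve-∀
Dᵀ-power u (false ∷ c) = Dᵀ-power u c

-- As for `Dᵀ-power`, but the rows above the topmost 1 become `false`, so the factor u^i drops out.
Uᵀ-power : ∀ u c → Uᵀ (power u) c ≡ power (1ℤ ⊕ u) c - 1ℤ
Uᵀ-power u [] = refl
Uᵀ-power u (true ∷ c)
  rewrite scale (Eᵀ-linear c) u (power u) | Eᵀ-power u c | Uᵀ-power u c = eq u (power (1ℤ ⊕ u) c)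
  where
  eq : ∀ u x → u * x ⊕ (x - 1ℤ) ≡ (1ℤ ⊕ u) * x - 1ℤ
  eq = solve-∀
Uᵀ-power u (false ∷ c) = Uᵀ-power u c

-- The new row's `u * power u c` cancels the term subtracted in `Dᵀ-power`, leaving only
-- `power (1ℤ ⊕ u) c` and a constant. Here `I m (power u)` is f_m(u).
I-power : ∀ m u → I (suc m) (power u)
                ≡ (u - + 2) * I m (power (1ℤ ⊕ u)) ⊕ + 2 * I m (power 1ℤ)
I-power m u = begin
  I m (λ c → power u (c ∷ʳ true) ⊕ Cᵀ (power u) c)
    ≡⟨ ext (I-linear m) step ⟩
  I m (λ c → (u - + 2) * power (1ℤ ⊕ u) c ⊕ + 2 * power 1ℤ c)
    ≡⟨ add (I-linear m) _ _ ⟩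
  I m (λ c → (u - + 2) * power (1ℤ ⊕ u) c) ⊕ I m (λ c → + 2 * power 1ℤ c)
    ≡⟨ cong₂ _⊕_ (scale (I-linear m) (u - + 2) _) (scale (I-linear m) (+ 2) _) ⟩
  (u - + 2) * I m (power (1ℤ ⊕ u)) ⊕ + 2 * I m (power 1ℤ) ∎
  where
  eq : ∀ u x y → u * y ⊕ (u * (x - y) ⊕ - + 2 * (x - 1ℤ)) ≡ (u - + 2) * x ⊕ + 2 * 1ℤ
  eq = solve-∀
  step : ∀ c → power u (c ∷ʳ true) ⊕ Cᵀ (power u) c ≡ (u - + 2) * power (1ℤ ⊕ u) c ⊕ + 2 * power 1ℤ c
  step c rewrite power-∷ʳ u c | Dᵀ-power u c | Uᵀ-power u c | power-1 c =
    eq u (power (1ℤ ⊕ u) c) (power u c)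

I-recurrence : ∀ m → I (suc (suc m)) (power 1ℤ)
                   ≡ + 2 * I (suc m) (power 1ℤ) - + 2 * I m (power 1ℤ)
I-recurrence m rewrite I-power (suc m) 1ℤ | I-power m (+ 2) =
  eq (I (suc m) (power 1ℤ)) (I m (power (+ 3))) (I m (power 1ℤ))
  where
  eq : ∀ x y z → -1ℤ * (0ℤ * y ⊕ + 2 * z) ⊕ + 2 * x ≡ + 2 * x - + 2 * z
  eq = solve-∀

-- Weights of permutation tableaux

all-applyUpTo : ∀ (p : A → Bool) f n → all p (applyUpTo f n) ≡ allTo n (p ∘ f)
all-applyUpTo p f zero = refl
all-applyUpTo p f (suc n) = cong (p (f 0) ∧_) (all-applyUpTo p (f ∘ suc) n)

any-applyUpTo : ∀ (p : A → Bool) f n → any p (applyUpTo f n) ≡ anyTo n (p ∘ f)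
any-applyUpTo p f zero = refl
any-applyUpTo p f (suc n) = cong (p (f 0) ∨_) (any-applyUpTo p (f ∘ suc) n)

allTo-true : ∀ n → allTo n (λ _ → true) ≡ true
allTo-true zero = refl
allTo-true (suc n) = allTo-true n

allTo-∧ : ∀ n p q → allTo n (λ i → p i ∧ q i) ≡ allTo n p ∧ allTo n q
allTo-∧ zero p q = refl
allTo-∧ (suc n) p q with p 0 | q 0
... | true  | true  = allTo-∧ n (p ∘ suc) (q ∘ suc)
... | true  | false = sym (∧-zeroʳ _)
... | false | _     = refl

allTo-swap : ∀ m n (p : ℕ → ℕ → Bool) →
  allTo m (λ i → allTo n (p i)) ≡ allTo n (λ j → allTo m (λ i → p i j))
allTo-swap zero n p = sym (allTo-true n)
allTo-swap (suc m) n p = begin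
  allTo n (p 0) ∧ allTo m (λ i → allTo n (p (suc i)))
    ≡⟨ cong (allTo n (p 0) ∧_) (allTo-swap m n (p ∘ suc)) ⟩
  allTo n (p 0) ∧ allTo n (λ j → allTo m (λ i → p (suc i) j))
    ≡⟨ allTo-∧ n (p 0) _ ⟨
  allTo n (λ j → p 0 j ∧ allTo m (λ i → p (suc i) j)) ∎

columnWeight : Bool → Bool → Bool → ℤ
columnWeight o q u = if o ∧ q then sgn (not u) else 0ℤ

-- The sign is multiplicative over columns; `o`, `q`, `u` stand for having a 1, having no bad zero
-- and being unrestricted.
prodTo-columnWeight : ∀ n (f : ℕ → ℕ) (o q u : ℕ → Bool) →
  (if all o (applyUpTo f n) ∧ all q (applyUpTo f n)
   then signPow (foldr ℕ._+_ 0 (map (λ j → if u j then 1 else 0) (applyUpTo f n))) else 0ℤ)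
  ≡ prodTo n (λ j → columnWeight (o (f j)) (q (f j)) (u (f j)))
prodTo-columnWeight zero f o q u = refl
prodTo-columnWeight (suc n) f o q u with prodTo-columnWeight n (f ∘ suc) o q u | o (f 0) | q (f 0) | u (f 0)
... | ih | false | _     | _     = refl
... | ih | true  | false | _     rewrite ∧-zeroʳ (all o (applyUpTo (f ∘ suc) n)) = refl
... | ih | true  | true  | false = trans ih (sym (ℤₚ.*-identityˡ _))
... | ih | true  | true  | true  =
  trans (if-neg (all o (applyUpTo (f ∘ suc) n) ∧ all q (applyUpTo (f ∘ suc) n)))
        (cong (-1ℤ *_) ih)
  where
  if-neg : ∀ b {x} → (if b then - x else 0ℤ) ≡ -1ℤ * (if b then x else 0ℤ)
  if-neg true {x} = sym (ℤₚ.-1*i≡-i x)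
  if-neg false = refl

-- The streams o, z, l read off the entries 1, the entries 0 and the 1s to the left of a column.
Describes : (o z l : ℕ → Bool) → Vec Cell r → Set
Describes {r} o z l cs = (i : Fin r) →
  o (toℕ i) ≡ isOne (proj₁ (lookup cs i)) ×
  z (toℕ i) ≡ isZero (proj₁ (lookup cs i)) ×
  l (toℕ i) ≡ proj₂ (lookup cs i)

allTo-κ≥ : (o z l : ℕ → Bool) (cs : Vec Cell r) → Describes o z l cs →
  (if allTo r (λ i → not (z i ∧ l i)) then 1ℤ else 0ℤ) ≡ κ≥ cs
allTo-κ≥ o z l [] d = refl
allTo-κ≥ o z l ((e , x) ∷ cs) d with e | x | d fzero
... | nothing    | _     | _ , z≡ , l≡ rewrite z≡ = allTo-κ≥ (o ∘ suc) (z ∘ suc) (l ∘ suc) cs (d ∘ fsuc)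
... | just true  | _     | _ , z≡ , l≡ rewrite z≡ = allTo-κ≥ (o ∘ suc) (z ∘ suc) (l ∘ suc) cs (d ∘ fsuc)
... | just false | true  | _ , z≡ , l≡ rewrite z≡ | l≡ = refl
... | just false | false | _ , z≡ , l≡ rewrite z≡ | l≡ = allTo-κ≥ (o ∘ suc) (z ∘ suc) (l ∘ suc) cs (d ∘ fsuc)

-- Below the topmost 1 a 0 with a 1 to its left is forbidden, so whether an admissible column is
-- unrestricted is decided above its topmost 1, by the flag.
allTo-κ : (o z l : ℕ → Bool) (b : Bool) (cs : Vec Cell r) → Describes o z l cs →
  (if anyTo r o ∧ allTo r (λ i → not (z i ∧ anyTo i o ∧ l i))
   then sgn (b ∨ not (allTo r (λ i → not (z i ∧ l i)))) else 0ℤ) ≡ κ b cs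
allTo-κ o z l b [] d = refl
allTo-κ {r = suc r} o z l b ((e , x) ∷ cs) d with e | d fzero
... | nothing    | o≡ , z≡ , l≡ rewrite o≡ | z≡ = allTo-κ (o ∘ suc) (z ∘ suc) (l ∘ suc) b cs (d ∘ fsuc)
... | just false | o≡ , z≡ , l≡ rewrite o≡ | z≡ | l≡ | sym (allTo-κ (o ∘ suc) (z ∘ suc) (l ∘ suc) (b ∨ x) cs (d ∘ fsuc)) =
  cong (λ y → if anyTo r (o ∘ suc) ∧ allTo r (λ i → not (z (suc i) ∧ anyTo i (o ∘ suc) ∧ l (suc i)))
              then sgn y else 0ℤ) (deMorgan x)
  where
  rest = allTo r (λ i → not (z (suc i) ∧ l (suc i)))
  deMorgan : ∀ x → b ∨ not (not x ∧ rest) ≡ (b ∨ x) ∨ not rest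
  deMorgan true rewrite ∨-zeroʳ b = refl
  deMorgan false rewrite ∨-identityʳ b = refl
-- From here on a 1 stands above, so condition (2) and the absence of column-restricted zeros are
-- the same test: if it holds the sign is `sgn b`, otherwise the weight is 0.
... | just true  | o≡ , z≡ , l≡ rewrite o≡ | z≡ | sym (allTo-κ≥ (o ∘ suc) (z ∘ suc) (l ∘ suc) cs (d ∘ fsuc))
  with allTo r (λ i → not (z (suc i) ∧ l (suc i)))
...   | true rewrite ∨-identityʳ b = sym (ℤₚ.*-identityʳ (sgn b))
...   | false = sym (ℤₚ.*-zeroʳ (sgn b))

!?-lookup : (xs : Vec A r) (i : Fin r) → toList xs !? toℕ i ≡ just (lookup xs i)
!?-lookup (x ∷ xs) fzero = refl
!?-lookup (x ∷ xs) (fsuc i) = !?-lookup xs i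

one?-lookup : (F : Vec Row r) (i : Fin r) (j : ℕ) →
  one? (toList F) (toℕ i) j ≡ isOne (lookup F i !? j)
one?-lookup F i j rewrite !?-lookup F i with lookup F i !? j
... | nothing = refl
... | just true = refl
... | just false = refl

zero?-lookup : (F : Vec Row r) (i : Fin r) (j : ℕ) →
  zero? (toList F) (toℕ i) j ≡ isZero (lookup F i !? j)
zero?-lookup F i j rewrite !?-lookup F i with lookup F i !? j
... | nothing = refl
... | just true = refl
... | just false = refl

describes-cells : (F : Vec Row r) (j : ℕ) →
  Describes (λ i → one? (toList F) i j) (λ i → zero? (toList F) i j) (λ i → oneLeft (toList F) i j)
            (cells (replicate r false) F j)
describes-cells {r} F j i
  rewrite lookup-zipWith (cell j) i (replicate r false) F | lookup-replicate i false =
  one?-lookup F i j , zero?-lookup F i j ,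
  trans (any-applyUpTo (one? (toList F) (toℕ i)) id j) (anyTo-cong j (one?-lookup F i))

if-∧ : ∀ a b c {x : ℤ} →
  (if a ∧ b ∧ c then x else 0ℤ) ≡ (if a ∧ b then (if c then x else 0ℤ) else 0ℤ)
if-∧ true true c = refl
if-∧ true false c = refl
if-∧ false b c = refl

columns-weight : (F : Vec Row r) →
  (if colsHaveOne (toList F) ∧ noBadZero (toList F) then signPow (urc (toList F)) else 0ℤ)
  ≡ prodTo (numCols (toList F)) (λ j → κ false (cells (replicate r false) F j))
columns-weight {r} F = begin
  (if colsHaveOne T ∧ noBadZero T then signPow (urc T) else 0ℤ)
    ≡⟨ cong (λ x → if colsHaveOne T ∧ x then signPow (urc T) else 0ℤ) noBadZero-columns ⟩
  (if colsHaveOne T ∧ allBelow C q then signPow (urc T) else 0ℤ)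
    ≡⟨ prodTo-columnWeight C id _ q (unrestricted T) ⟩
  prodTo C (λ j → columnWeight (anyBelow (numRows T) (λ i → one? T i j)) (q j) (unrestricted T j))
    ≡⟨ prodTo-cong C column ⟩
  prodTo C (λ j → κ false (cells (replicate r false) F j)) ∎
  where
  T = toList F
  C = numCols T
  q : ℕ → Bool
  q j = allTo r (λ i → not (zero? T i j ∧ anyTo i (λ k → one? T k j) ∧ oneLeft T i j))

  noBadZero-columns : noBadZero T ≡ allBelow C q
  noBadZero-columns = begin
    noBadZero T
      ≡⟨ all-applyUpTo _ id (numRows T) ⟩
    allTo (numRows T) (λ i → allBelow C (λ j → not (zero? T i j ∧ oneAbove T i j ∧ oneLeft T i j)))
      ≡⟨ cong (λ k → allTo k (λ i → allBelow C (λ j → not (zero? T i j ∧ oneAbove T i j ∧ oneLeft T i j))))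
           (length-toList F) ⟩
    allTo r (λ i → allBelow C (λ j → not (zero? T i j ∧ oneAbove T i j ∧ oneLeft T i j)))
      ≡⟨ allTo-cong r (λ i → trans (all-applyUpTo _ id C) (allTo-cong C (λ j →
           cong (λ y → not (zero? T i j ∧ y ∧ oneLeft T i j)) (any-applyUpTo _ id i)))) ⟩
    allTo r (λ i → allTo C (λ j → not (zero? T i j ∧ anyTo i (λ k → one? T k j) ∧ oneLeft T i j)))
      -- Condition (2) is checked row by row, whereas the weight is a product over columns.
      ≡⟨ allTo-swap r C _ ⟩
    allTo C q
      ≡⟨ all-applyUpTo q id C ⟨
    allBelow C q ∎

  column : ∀ j → columnWeight (anyBelow (numRows T) (λ i → one? T i j)) (q j) (unrestricted T j)
               ≡ κ false (cells (replicate r false) F j)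
  column j
    rewrite length-toList F
          | any-applyUpTo (λ i → one? T i j) id r
          | all-applyUpTo (λ i → not (colRestricted T i j)) id r
    = allTo-κ (λ i → one? T i j) (λ i → zero? T i j) (λ i → oneLeft T i j) false
        (cells (replicate r false) F j) (describes-cells F j)

tableau-weight : ∀ n (F : Vec Row r) →
  (if isPT n (toList F) then signPow (urc (toList F)) else 0ℤ) ≡ weight (replicate r false) F n
tableau-weight {r} n F = begin
  (if isPT n T then signPow (urc T) else 0ℤ)
    ≡⟨ if-∧ (decreasing T) (numRows T ℕ.+ numCols T ≡ᵇ n) _ ⟩
  (if decreasing T ∧ (numRows T ℕ.+ numCols T ≡ᵇ n)
   then (if colsHaveOne T ∧ noBadZero T then signPow (urc T) else 0ℤ) else 0ℤ)
    ≡⟨ cong₂ (λ k x → if decreasing T ∧ (k ℕ.+ numCols T ≡ᵇ n) then x else 0ℤ)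
         (length-toList F) (columns-weight F) ⟩
  weight (replicate r false) F n ∎
  where
  T = toList F

s≡I : ∀ n → s n ≡ I n (power 1ℤ)
s≡I n = begin
  s n
    ≡⟨ sumL-filter (isPT n) (candidates n) (signPow ∘ urc) ⟩
  sumL (candidates n) h
    ≡⟨ sumL-concatMap (λ r → listsOf r (rowsUpTo n)) (upTo (suc n)) h ⟩
  sumL (upTo (suc n)) (λ r → sumL (listsOf r (rowsUpTo n)) h)
    ≡⟨ ext (sumL-linear (upTo (suc n))) rows ⟩
  sumL (upTo (suc n)) (λ r → I n (λ c → ev c (replicate r false)))
    -- With the sum over row numbers inside, exactly one `r` matches each word reached, which turns
    -- `ev` into the constant 1.
    ≡⟨ sumL-swap (I-linear n) (upTo (suc n)) _ ⟩
  I n (λ c → sumL (upTo (suc n)) (λ r → ev c (replicate r false)))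
    ≡⟨ I-ext n (λ c l → trans (sum-ev n c l) (sym (power-1 c))) ⟩
  I n (power 1ℤ) ∎
  where
  h : Filling → ℤ
  h F = if isPT n F then signPow (urc F) else 0ℤ
  rows : ∀ r → sumL (listsOf r (rowsUpTo n)) h ≡ I n (λ c → ev c (replicate r false))
  rows r = begin
    sumL (listsOf r (rowsUpTo n)) h
      ≡⟨ sumL-listsOf r (rowsUpTo n) h ⟩
    sumV (rowsUpTo n) r (h ∘ toList)
      ≡⟨ ext (sumV-linear (rowsUpTo n) r) (tableau-weight n) ⟩
    sumV (rowsUpTo n) r (λ F → weight (replicate r false) F n)
      ≡⟨ sumV-weight n n (replicate r false) ℕₚ.≤-refl ⟩
    I n (λ c → ev c (replicate r false)) ∎

theorem1p3 : (n : ℕ) → 3 ≤ n → s n ≡ (+ 2) * s (n ∸ 1) - (+ 2) * s (n ∸ 2)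
theorem1p3 (suc (suc m)) _ = begin
  s (suc (suc m))
    ≡⟨ s≡I (suc (suc m)) ⟩
  I (suc (suc m)) (power 1ℤ)
    ≡⟨ I-recurrence m ⟩
  + 2 * I (suc m) (power 1ℤ) - + 2 * I m (power 1ℤ)
    ≡⟨ cong₂ (λ x y → + 2 * x - + 2 * y) (s≡I (suc m)) (s≡I m) ⟨
  + 2 * s (suc m) - + 2 * s m ∎
theorem1p3 (suc zero) (s≤s ())
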